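{- (Reliability/soundness of KEDL.) For every set $\Gamma$ of KEDL concepts and every KEDL concept $\phi$: if $\Gamma\vdash\phi$ then $\Gamma\models\phi$.
   Context: KEDL syntax. Fix countable pairwise disjoint sets of object concept names, attribute concept names, and role names $\mathbf P$ (object–object), $\mathbf Q$ (attribute–attribute), $\mathbf R$ (object–attribute); $r^-$ is the inverse of $r\in\mathbf R$. Object concepts $\Phi$ and attribute concepts $\Omega$ are the least sets such that: object concept names, $\top,\bot\in\Phi$; attribute concept names $\in\Omega$; $C,D\in\Phi\Rightarrow\neg C,C\sqcap D,C\sqcup D\in\Phi$; $p\in\mathbf P,C\in\Phi\Rightarrow\forall p.C,\exists p.C\in\Phi$; $r\in\mathbf R,A\in\Omega\Rightarrow\forall r.A,\exists r.A\in\Phi$; $A,B\in\Omega\Rightarrow\neg A,A\sqcap B,A\sqcup B\in\Omega$; $q\in\mathbf Q,A\in\Omega\Rightarrow\forall q.A,\exists q.A\in\Omega$; $r\in\mathbf R,C\in\Phi\Rightarrow\forall r^-.C,\exists r^-.C\in\Omega$. For same-sort $\phi,\psi$, $\phi\to\psi$ stands for $\neg\phi\sqcup\psi$ and $\phi\leftrightarrow\psi$ for $(\phi\to\psi)\sqcap(\psi\to\phi)$. KEDL model $M=(\Delta^I,\Sigma^I,\cdot^I)$: $\Delta^I,\Sigma^I$ nonempty; object concept names $\mapsto$ subsets of $\Delta^I$, attribute concept names $\mapsto$ subsets of $\Sigma^I$, $p^I\subseteq\Delta^I\times\Delta^I$, $q^I\subseteq\Sigma^I\times\Sigma^I$, $r^I\subseteq\Delta^I\times\Sigma^I$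 with each $x\in\Delta^I$ having exactly one $r^I$-successor; $(r^-)^I$ is the converse of $r^I$. Extension: $\top^I=\Delta^I,\bot^I=\emptyset$; complement relative to the domain of the sort; $\sqcap,\sqcup$ as $\cap,\cup$; $(\forall s.E)^I=\{x:\forall y((x,y)\in s^I\Rightarrow y\in E^I)\}$, $(\exists s.E)^I=\{x:\exists y((x,y)\in s^I\wedge y\in E^I)\}$ for $s\in\mathbf P\cup\mathbf Q\cup\mathbf R\cup\{r^-\}$, $x$ ranging over the domain of the source sort of $s$. A concept is valid in $M$ if its interpretation is the whole domain of its sort. $\Gamma\models\phi$: in every model where all members of $\Gamma$ are valid, $\phi$ is valid. Deduction: $\Gamma\vdash\phi$ iff there is a finite sequence $\phi_1,\dots,\phi_n=\phi$ where each $\phi_k$ is a member of $\Gamma$, or an instance of an axiom scheme (A1)–(A17), or follows by modus ponens from earlier $\phi_i$ and $\phi_j=\phi_i\to\phi_k$, or follows from earlier members by rule (R19) (from $\alpha\to\beta$, $\beta\to\alpha$ infer $\alpha\leftrightarrow\beta$), (R20) (from $\alpha\to\beta$, $\beta\to\gamma$ infer $\alpha\to\gamma$), or (R21) (from $\alpha\to\beta\sqcap\gamma$ infer $\alpha\to\beta$ and $\alpha\to\gamma$, and conversely). Axiom schemes (same-sort $\phi,\psi,\gamma$; $C,D\in\Phi$; $A,B\in\Omega$): (A1) $\phi\to(\psi\to\phi)$; (A2) $(\phi\to(\psi\to\gamma))\to((\phi\to\psi)\to(\phi\to\gamma))$; (A3) $(\neg\phi\to\neg\psi)\to(\psi\to\phi)$;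 for $(s,E,F)$ equal to $(p,C,D)$ [A4–A6], $(q,A,B)$ [A7–A9], $(r,A,B)$ [A10–A12], $(r^-,C,D)$ [A13–A15]: $(\exists s.E\sqcup\exists s.F)\to\exists s.(E\sqcup F)$, $\exists s.(E\sqcap F)\to(\exists s.E\sqcap\exists s.F)$, $(\exists s.E\sqcap\forall s.F)\to\exists s.(E\sqcap F)$; (A16) $\exists r^-.\forall r.A\to A$; (A17) $\exists r.\forall r^-.C\to C$. -}

module Defs where

open import Data.Empty.Polymorphic using (⊥)
open import Data.List.Base using (List; []; _∷_)
open import Data.List.Membership.Propositional using () renaming (_∈_ to _∈ₗ_)
open import Data.Nat.Base using (ℕ)
open import Data.Product.Base using (∃; _×_; _,_)
open import Data.Product using (∃!)
open import Data.Unit.Polymorphic using (⊤)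
open import Function.Bundles using (_↣_)
open import Level using (Level; suc) renaming (_⊔_ to _⊔ˡ_)
open import Relation.Binary.Core using (REL; Rel)
open import Relation.Binary.PropositionalEquality.Core using (_≡_)
open import Relation.Unary using (Pred; _∈_; ∁; _∩_; _∪_; Universal)

-- Distinct sets of symbols are distinct types, hence disjoint by construction.
-- "Countable" allows finite sets.
record Vocabulary : Set₁ where
  field
    ObjectName    : Set
    AttributeName : Set
    𝐏 𝐐 𝐑         : Set
    ObjectName-countable    : ObjectName ↣ ℕ
    AttributeName-countable : AttributeName ↣ ℕ
    𝐏-countable             : 𝐏 ↣ ℕ
    𝐐-countable             : 𝐐 ↣ ℕ
    𝐑-countable             : 𝐑 ↣ ℕ

data Sort : Set where
  object attribute : Sort

module KEDL (V : Vocabulary) where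

  open Vocabulary V

  data Role : Sort → Sort → Set where
    𝐩  : 𝐏 → Role object object
    𝐪  : 𝐐 → Role attribute attribute
    𝐫  : 𝐑 → Role object attribute
    𝐫⁻ : 𝐑 → Role attribute object

  infix  9 ∼_ ∀[_]_ ∃[_]_
  infixr 8 _⊓_
  infixr 7 _⊔_
  infixr 6 _⇒_
  infix  5 _⇔_

  -- Φ is Concept object and Ω is Concept attribute.
  data Concept : Sort → Set where
    objectName    : ObjectName → Concept object
    attributeName : AttributeName → Concept attribute
    top bot       : Concept object
    ∼_            : ∀ {s} → Concept s → Concept s
    _⊓_ _⊔_       : ∀ {s} → Concept s → Concept s → Concept s
    ∀[_]_ ∃[_]_   : ∀ {s t} → Role s t → Concept t → Concept s

  _⇒_ : ∀ {s} → Concept s → Concept s → Concept s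
  φ ⇒ ψ = ∼ φ ⊔ ψ

  _⇔_ : ∀ {s} → Concept s → Concept s → Concept s
  φ ⇔ ψ = (φ ⇒ ψ) ⊓ (ψ ⇒ φ)

  AnyConcept : Set
  AnyConcept = ∃ Concept

  record Model (ℓ : Level) : Set (suc ℓ) where
    field
      Δ : Set ℓ
      Σ : Set ℓ
      Δ-nonempty : Δ
      Σ-nonempty : Σ
      objectNameᴵ    : ObjectName → Pred Δ ℓ
      attributeNameᴵ : AttributeName → Pred Σ ℓ
      𝐩ᴵ : 𝐏 → Rel Δ ℓ
      𝐪ᴵ : 𝐐 → Rel Σ ℓ
      𝐫ᴵ : 𝐑 → REL Δ Σ ℓ
      𝐫ᴵ-functional : ∀ r x → ∃! _≡_ (𝐫ᴵ r x)

    Domain : Sort → Set ℓ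
    Domain object    = Δ
    Domain attribute = Σ

    ⟦_⟧ᴿ : ∀ {s t} → Role s t → REL (Domain s) (Domain t) ℓ
    ⟦ 𝐩 p ⟧ᴿ      = 𝐩ᴵ p
    ⟦ 𝐪 q ⟧ᴿ      = 𝐪ᴵ q
    ⟦ 𝐫 r ⟧ᴿ      = 𝐫ᴵ r
    ⟦ 𝐫⁻ r ⟧ᴿ y x = 𝐫ᴵ r x y

    -- Pitfall: ∁ and ∪ are constructive here, and φ ⇒ ψ unfolds to ∁ φ ∪ ψ, so
    -- even validity of φ ⇒ φ says that membership in φ is decidable.  Under
    -- excluded middle this is the usual set-theoretic semantics.
    ⟦_⟧ : ∀ {s} → Concept s → Pred (Domain s) ℓ
    ⟦ objectName c ⟧    = objectNameᴵ c
    ⟦ attributeName a ⟧ = attributeNameᴵ a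
    ⟦ top ⟧             = λ _ → ⊤
    ⟦ bot ⟧             = λ _ → ⊥
    ⟦ ∼ φ ⟧             = ∁ ⟦ φ ⟧
    ⟦ φ ⊓ ψ ⟧           = ⟦ φ ⟧ ∩ ⟦ ψ ⟧
    ⟦ φ ⊔ ψ ⟧           = ⟦ φ ⟧ ∪ ⟦ ψ ⟧
    ⟦ ∀[ s ] E ⟧        = λ x → ∀ y → ⟦ s ⟧ᴿ x y → y ∈ ⟦ E ⟧
    ⟦ ∃[ s ] E ⟧        = λ x → ∃ λ y → ⟦ s ⟧ᴿ x y × y ∈ ⟦ E ⟧

    Valid : ∀ {s} → Concept s → Set ℓ
    Valid φ = Universal ⟦ φ ⟧

  -- Semantic consequence over models living in universe ℓ.
  infix 4 _⊨[_]_
  _⊨[_]_ : ∀ {γ s} → Pred AnyConcept γ → (ℓ : Level) → Concept s → Set (γ ⊔ˡ suc ℓ)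
  Γ ⊨[ ℓ ] φ = (M : Model ℓ) → let open Model M in
               (∀ {t} (ψ : Concept t) → (t , ψ) ∈ Γ → Valid ψ) → Valid φ

  -- σ ranges over all four kinds of role: p, q, r and r⁻.
  data Axiom : ∀ {s} → Concept s → Set where
    weakening      : ∀ {s} (φ ψ : Concept s) → Axiom (φ ⇒ (ψ ⇒ φ))
    distribution   : ∀ {s} (φ ψ χ : Concept s) →
                     Axiom ((φ ⇒ (ψ ⇒ χ)) ⇒ ((φ ⇒ ψ) ⇒ (φ ⇒ χ)))
    contraposition : ∀ {s} (φ ψ : Concept s) → Axiom ((∼ φ ⇒ ∼ ψ) ⇒ (ψ ⇒ φ))
    ∃-⊔            : ∀ {s t} (σ : Role s t) (E F : Concept t) →
                     Axiom ((∃[ σ ] E ⊔ ∃[ σ ] F) ⇒ ∃[ σ ] (E ⊔ F))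
    ∃-⊓            : ∀ {s t} (σ : Role s t) (E F : Concept t) →
                     Axiom (∃[ σ ] (E ⊓ F) ⇒ (∃[ σ ] E ⊓ ∃[ σ ] F))
    ∃-∀            : ∀ {s t} (σ : Role s t) (E F : Concept t) →
                     Axiom ((∃[ σ ] E ⊓ ∀[ σ ] F) ⇒ ∃[ σ ] (E ⊓ F))
    ∃⁻-∀           : ∀ (r : 𝐑) (A : Concept attribute) →
                     Axiom (∃[ 𝐫⁻ r ] (∀[ 𝐫 r ] A) ⇒ A)
    ∃-∀⁻           : ∀ (r : 𝐑) (C : Concept object) →
                     Axiom (∃[ 𝐫 r ] (∀[ 𝐫⁻ r ] C) ⇒ C)

  -- Step Γ φs φ: φ may be added to a sequence whose earlier members are φs.
  data Step {γ} (Γ : Pred AnyConcept γ) (φs : List AnyConcept) :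
            ∀ {s} → Concept s → Set γ where
    premise : ∀ {s} {φ : Concept s} → (s , φ) ∈ Γ → Step Γ φs φ
    axiom   : ∀ {s} {φ : Concept s} → Axiom φ → Step Γ φs φ
    mp      : ∀ {s} {φ ψ : Concept s} →
              (s , φ) ∈ₗ φs → (s , φ ⇒ ψ) ∈ₗ φs → Step Γ φs ψ
    ⇔-intro : ∀ {s} {α β : Concept s} →
              (s , α ⇒ β) ∈ₗ φs → (s , β ⇒ α) ∈ₗ φs → Step Γ φs (α ⇔ β)
    ⇒-trans : ∀ {s} {α β χ : Concept s} →
              (s , α ⇒ β) ∈ₗ φs → (s , β ⇒ χ) ∈ₗ φs → Step Γ φs (α ⇒ χ)
    ⊓-elimˡ : ∀ {s} {α β χ : Concept s} →
              (s , α ⇒ β ⊓ χ) ∈ₗ φs → Step Γ φs (α ⇒ β)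
    ⊓-elimʳ : ∀ {s} {α β χ : Concept s} →
              (s , α ⇒ β ⊓ χ) ∈ₗ φs → Step Γ φs (α ⇒ χ)
    ⊓-intro : ∀ {s} {α β χ : Concept s} →
              (s , α ⇒ β) ∈ₗ φs → (s , α ⇒ χ) ∈ₗ φs → Step Γ φs (α ⇒ β ⊓ χ)

  -- Sequences are stored in reverse: the head of the list is the last formula.
  data IsDeduction {γ} (Γ : Pred AnyConcept γ) : List AnyConcept → Set γ where
    []  : IsDeduction Γ []
    _∷_ : ∀ {s} {φ : Concept s} {φs} →
          Step Γ φs φ → IsDeduction Γ φs → IsDeduction Γ ((s , φ) ∷ φs)

  infix 4 _⊢_
  _⊢_ : ∀ {γ s} → Pred AnyConcept γ → Concept s → Set γ
  Γ ⊢ φ = ∃ λ φs → IsDeduction Γ ((_ , φ) ∷ φs)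

{-# OPTIONS --safe #-}
module Submission where

open import Axiom.ExcludedMiddle using (ExcludedMiddle)
open import Data.List.Base using (List)
open import Data.List.Relation.Unary.All as All using (All; []; _∷_)
open import Data.Product.Base using (_×_; _,_; proj₁; proj₂)
open import Data.Sum.Base using (_⊎_; inj₁; inj₂; [_,_])
open import Function.Base using (_∘_)
open import Level using (Level)
open import Relation.Nullary using (¬_; yes; no; contradiction)
open import Relation.Nullary.Decidable using (decidable-stable)
open import Relation.Unary using (Pred; _∈_)
open import Defs

-- Fix a model in which every member of `Γ` is valid and induct along the deduction: axioms are
-- valid and each rule preserves validity, so every formula of the sequence is valid. Both checks
-- are made pointwise. At a point, `φ ⇒ ψ` means `¬ A ⊎ B`; `¬⊎⇒→` and `→⇒¬⊎` trade this for the
-- function type `A → B`. After the trade, rules become application, composition, pairing and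
-- projection, and all axioms except contraposition have direct constructive proofs.

¬⊎⇒→ : ∀ {a b} {A : Set a} {B : Set b} → ¬ A ⊎ B → A → B
¬⊎⇒→ (inj₁ ¬a) a = contradiction a ¬a
¬⊎⇒→ (inj₂ b)  _ = b

module Soundness {ℓ} (em : ExcludedMiddle ℓ) (V : Vocabulary)
                 (M : KEDL.Model V ℓ) where

  open KEDL V
  open Model M

  -- This is the classical direction of the trade: the disjunct can be chosen only by deciding `A`.
  →⇒¬⊎ : {A B : Set ℓ} → (A → B) → ¬ A ⊎ B
  →⇒¬⊎ {A} f with em {A}
  ... | yes a = inj₂ (f a)
  ... | no ¬a = inj₁ ¬a

  axiom-valid : ∀ {s} {φ : Concept s} → Axiom φ → Valid φ
  axiom-valid (weakening _ _) _ = →⇒¬⊎ λ a → →⇒¬⊎ λ _ → a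
  axiom-valid (distribution _ _ _) _ =
    →⇒¬⊎ λ f → →⇒¬⊎ λ g → →⇒¬⊎ λ a → ¬⊎⇒→ (¬⊎⇒→ f a) (¬⊎⇒→ g a)
  axiom-valid (contraposition _ _) _ =
    -- The one axiom that is classical even for function types: refuting `¬a` gives only a double
    -- negation, which `em` removes.
    →⇒¬⊎ λ f → →⇒¬⊎ λ b → decidable-stable em λ ¬a → ¬⊎⇒→ f ¬a b
  axiom-valid (∃-⊔ _ _ _) _ = →⇒¬⊎
    [ (λ (y , σxy , e) → y , σxy , inj₁ e)
    , (λ (y , σxy , f) → y , σxy , inj₂ f) ]
  axiom-valid (∃-⊓ _ _ _) _ = →⇒¬⊎
    λ (y , σxy , e , f) → (y , σxy , e) , (y , σxy , f)
  axiom-valid (∃-∀ _ _ _) _ = →⇒¬⊎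
    λ ((y , σxy , e) , f) → y , σxy , e , f y σxy
  -- Going back along the converse role and forward again may return to the start: `𝐫⁻ r` unfolds to
  -- `𝐫ᴵ r` with its arguments swapped, so the same `rxy` witnesses both steps. The next axiom is
  -- the mirror image.
  axiom-valid (∃⁻-∀ _ _) y = →⇒¬⊎ λ (_ , rxy , f) → f y rxy
  axiom-valid (∃-∀⁻ _ _) x = →⇒¬⊎ λ (_ , rxy , f) → f x rxy

  module _ {γ} {Γ : Pred AnyConcept γ}
           (Γ-valid : ∀ {t} (ψ : Concept t) → (t , ψ) ∈ Γ → Valid ψ) where

    AllValid : Pred (List AnyConcept) ℓ
    AllValid = All {p = ℓ} λ (_ , φ) → Valid φ

    step-valid : ∀ {φs s} {φ : Concept s} →
                 AllValid φs → Step Γ φs φ → Valid φ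
    step-valid vs (premise φ∈Γ) = Γ-valid _ φ∈Γ
    step-valid vs (axiom a)     = axiom-valid a
    step-valid vs (mp i j) x    = ¬⊎⇒→ (All.lookup vs j x) (All.lookup vs i x)
    step-valid vs (⇔-intro i j) x = All.lookup vs i x , All.lookup vs j x
    step-valid vs (⇒-trans i j) x =
      →⇒¬⊎ (¬⊎⇒→ (All.lookup vs j x) ∘ ¬⊎⇒→ (All.lookup vs i x))
    step-valid vs (⊓-elimˡ i) x = →⇒¬⊎ (proj₁ ∘ ¬⊎⇒→ (All.lookup vs i x))
    step-valid vs (⊓-elimʳ i) x = →⇒¬⊎ (proj₂ ∘ ¬⊎⇒→ (All.lookup vs i x))
    step-valid vs (⊓-intro i j) x =
      →⇒¬⊎ λ a → ¬⊎⇒→ (All.lookup vs i x) a , ¬⊎⇒→ (All.lookup vs j x) a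

    -- The induction hypothesis must cover the whole sequence and not only its last formula, because
    -- a rule may cite any earlier member.
    deduction-valid : ∀ {φs} → IsDeduction Γ φs → AllValid φs
    deduction-valid []       = []
    deduction-valid (st ∷ d) = step-valid vs st ∷ vs
      where vs = deduction-valid d

theorem2 : ∀ {ℓ γ : Level} → ExcludedMiddle ℓ →
    (V : Vocabulary) → let open KEDL V in
    (Γ : Pred AnyConcept γ) {s : Sort} (φ : Concept s) →
    Γ ⊢ φ → Γ ⊨[ ℓ ] φ
theorem2 em V Γ φ (_ , d) M Γ-valid =
  All.head (Soundness.deduction-valid em V M Γ-valid d)
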